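{- Let $c(0)=1$ and $c(2m-1)=c(2m)=(-1)^mC_m$ for $m\ge1$, where $C_m$ are the Catalan numbers, so that $(c(n))_{n\ge0}=(1,-1,-1,2,2,-5,-5,\dots)$. Let $(\bar c(n))_{n\ge 0}=(c(0),0,c(1),0,c(2),0,\dots)$, i.e. $\bar c(2n)=c(n)$ and $\bar c(2n+1)=0$ for $n\ge 0$. Set $\bar d_0(n)=\det(\bar c(i+j))_{i,j=0}^{n-1}$ and $\bar d_1(n)=\det(\bar c(i+j+1))_{i,j=0}^{n-1}$. Then for all integers $n\ge 0$ $$\bar d_0(4n)=F_{2n+1}F_{2n+2},\quad \bar d_0(4n+1)=F_{2n+2}^2,\quad \bar d_0(4n+2)=-F_{2n+2}^2,\quad \bar d_0(4n+3)=F_{2n+2}F_{2n+3},$$ and $$\bar d_1(2n+1)=0,\quad \bar d_1(4n)=F_{2n+2}^2,\quad \bar d_1(4n+2)=-F_{2n+2}^2.$$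
   Context: $C_n=\frac{1}{n+1}\binom{2n}{n}$ is the $n$-th Catalan number. $F_n$ is the Fibonacci sequence $F_0=0$, $F_1=1$, $F_n=F_{n-1}+F_{n-2}$. The determinant of the empty ($0\times 0$) matrix is $1$. -}

module Defs where

open import Data.Nat.Base as ℕ using (ℕ; zero; suc; ⌈_/2⌉)
open import Data.Nat.Combinatorics using (_C_)
open import Data.Nat.DivMod using (_/_)
open import Data.Nat.Properties using (*-suc)
open import Data.Integer.Base using (ℤ; +_; 0ℤ; 1ℤ; -1ℤ; _*_; _^_)
open import Data.Integer.Properties using (+-0-commutativeMonoid)
open import Data.Fin.Base using (Fin; zero; suc; toℕ)
open import Data.Vec.Functional using (Vector; removeAt)
open import Algebra.Properties.CommutativeMonoid.Sum +-0-commutativeMonoid using (sum)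
open import Function.Base using (_∘_)
open import Relation.Binary.PropositionalEquality using (_≡_; refl; trans; cong)

-- Truncated division loses nothing here: n + 1 divides the central
-- binomial coefficient.
catalan : ℕ → ℕ
catalan n = ((2 ℕ.* n) C n) / suc n

F : ℕ → ℕ
F zero          = 0
F (suc zero)    = 1
F (suc (suc n)) = F (suc n) ℕ.+ F n

-- For m ≥ 1, the indices k with ⌈ k /2⌉ = m are exactly 2m - 1 and 2m.
c : ℕ → ℤ
c zero      = 1ℤ
c n@(suc _) = (-1ℤ ^ ⌈ n /2⌉) * + catalan ⌈ n /2⌉

-- The sequence f 0, 0, f 1, 0, f 2, 0, …
interleave0 : (ℕ → ℤ) → ℕ → ℤ
interleave0 f zero          = f zero
interleave0 f (suc zero)    = 0ℤ
interleave0 f (suc (suc n)) = interleave0 (f ∘ suc) n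

cbar : ℕ → ℤ
cbar = interleave0 c

Matrix : ℕ → Set
Matrix n = Vector (Vector ℤ n) n

-- Laplace expansion along the first row.
det : ∀ {n} → Matrix n → ℤ
det {zero}  M = 1ℤ
det {suc n} M = sum λ j →
  (-1ℤ ^ toℕ j) * M zero j * det (λ i → removeAt (M (suc i)) j)

dbar₀ : ℕ → ℤ
dbar₀ n = det {n} λ i j → cbar (toℕ i ℕ.+ toℕ j)

dbar₁ : ℕ → ℤ
dbar₁ n = det {n} λ i j → cbar (toℕ i ℕ.+ toℕ j ℕ.+ 1)

⌈2*n/2⌉ : ∀ n → ⌈ 2 ℕ.* n /2⌉ ≡ n
⌈2*n/2⌉ zero    = refl
⌈2*n/2⌉ (suc n) = trans (cong ⌈_/2⌉ (*-suc 2 n)) (cong suc (⌈2*n/2⌉ n))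

⌈1+2*n/2⌉ : ∀ n → ⌈ suc (2 ℕ.* n) /2⌉ ≡ suc n
⌈1+2*n/2⌉ zero    = refl
⌈1+2*n/2⌉ (suc n) =
  trans (cong (⌈_/2⌉ ∘ suc) (*-suc 2 n)) (cong suc (⌈1+2*n/2⌉ n))

c-even : ∀ m → c (2 ℕ.* m) ≡ (-1ℤ ^ m) * + catalan m
c-even zero    = refl
c-even m@(suc _) = cong (λ k → (-1ℤ ^ k) * + catalan k) (⌈2*n/2⌉ m)

-- Stated at m = suc n, so that 2m - 1 = 1 + 2n.
c-odd : ∀ n → c (suc (2 ℕ.* n)) ≡ (-1ℤ ^ suc n) * + catalan (suc n)
c-odd n = cong (λ k → (-1ℤ ^ k) * + catalan k) (⌈1+2*n/2⌉ n)

interleave0-even : ∀ f n → interleave0 f (2 ℕ.* n) ≡ f n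
interleave0-even f zero    = refl
interleave0-even f (suc n) =
  trans (cong (interleave0 f) (*-suc 2 n)) (interleave0-even (f ∘ suc) n)

interleave0-odd : ∀ f n → interleave0 f (suc (2 ℕ.* n)) ≡ 0ℤ
interleave0-odd f zero    = refl
interleave0-odd f (suc n) =
  trans (cong (interleave0 f ∘ suc) (*-suc 2 n)) (interleave0-odd (f ∘ suc) n)

{-# OPTIONS --safe #-}
module Submission where

-- Let L be the functional whose moments are the signed aerated Catalan numbers
-- 1, 0, -1, 0, 2, 0, -5, … Its orthogonal polynomials are the Fibonacci polynomials
-- pₙ₊₂ = x pₙ₊₁ + pₙ, and c n = L(xⁿ (1 + x)). By Christoffel's formula the orthogonal
-- polynomials of L((1 + x) ·) and L(x (1 + x) ·) are combinations of the pₙ whose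
-- coefficients are the values pₙ(-1) = ± Fₙ₊₁; substituting x² for x and multiplying the
-- latter by x gives those of cbar. A degree n polynomial with leading coefficient s that
-- is orthogonal to all lower degrees replaces the last column of the Hankel matrix by
-- (0, …, 0, t), so s Dₙ₊₁ = t Dₙ for the Hankel determinants.

open import Defs
open import Data.Nat.Base as ℕ using (ℕ; zero; suc; s≤s; z≤n; _<_; _≤_)
import Data.Nat.Properties as ℕₚ
open import Data.Nat.Combinatorics using (_C_; nCk≡nC[n∸k]; nCn≡1; nCk+nC[k+1]≡[n+1]C[k+1]; k>n⇒nCk≡0)
open import Data.Nat.DivMod using (_/_; m*n/n≡m; /-congˡ)
open import Data.Integer.Base using (ℤ; +_; -_; _-_; _+_; _*_; _^_; 0ℤ; 1ℤ; -1ℤ)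
open import Data.Integer.Properties
open import Data.Integer.Tactic.RingSolver using (solve-∀)
open import Algebra.Properties.CommutativeMonoid.Sum +-0-commutativeMonoid using (sum; sum-cong-≗)
open import Data.Vec.Functional using (Vector; removeAt)
open import Data.Fin.Base using (Fin; zero; suc; toℕ; punchIn)
open import Data.List.Base using (List; []; _∷_; _++_; _∷ʳ_; map; length; tabulate; applyUpTo)
open import Data.List.Properties using
  (map-++; length-map; map-tabulate; ++-assoc; length-applyUpTo; length-++-comm; applyUpTo-∷ʳ)
open import Data.List.Membership.Propositional using (_∈_)
open import Data.List.Membership.Propositional.Properties using (∈-∃++; ∈-applyUpTo⁺; ∈-++⁺ˡ)
open import Data.Product.Base using (_×_; _,_)
open import Function.Base using (_∘_)
open import Relation.Binary.PropositionalEquality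
open ≡-Reasoning

-- Laplace expansion over lists of columns

Col : Set
Col = ℕ → ℤ

-- A column stands for a polynomial p through its moments i ↦ L(xⁱ p), so this is both deletion of
-- the top row and multiplication of p by x.
E : Col → Col
E f i = f (suc i)

-- The expansion along the first row, with the minors given by an arbitrary
-- function of the remaining columns: a minor keeps the columns to the left of
-- the deleted one, so in a recursion on the list they move into Φ.
expand : (List Col → ℤ) → List Col → ℤ
expand Φ []       = 0ℤ
expand Φ (x ∷ xs) = x 0 * Φ xs - expand (Φ ∘ (x ∷_)) xs

-- The value 0 on lists of the wrong length lets alternation and linearity hold without length
-- hypotheses.
Δ : ℕ → List Col → ℤ
Δ zero    []      = 1ℤ
Δ zero    (_ ∷ _) = 0ℤ
Δ (suc n) xs      = expand (Δ n ∘ map E) xs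

sum-*ˡ : ∀ {n} a (f : Vector ℤ n) → sum (λ j → a * f j) ≡ a * sum f
sum-*ˡ {zero}  a f = sym (*-zeroʳ a)
sum-*ˡ {suc n} a f = trans (cong (λ z → a * f zero + z) (sum-*ˡ a (f ∘ suc)))
                           (sym (*-distribˡ-+ a (f zero) _))

laplace-expand : ∀ {n} Φ (v : Fin (suc n) → Col) →
  sum (λ j → (-1ℤ ^ toℕ j) * v j 0 * Φ (tabulate (removeAt v j))) ≡ expand Φ (tabulate v)
laplace-expand {zero}  Φ v = lemma (v zero 0) (Φ [])
  where
  lemma : ∀ a b → 1ℤ * a * b + 0ℤ ≡ a * b - 0ℤ
  lemma = solve-∀
laplace-expand {suc n} Φ v = begin
  1ℤ * v₀ 0 * Φ (tabulate (v ∘ suc)) + sum (λ j → (-1ℤ * s j) * a j * m j)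
    ≡⟨ cong₂ _+_ (cong (_* Φ (tabulate (v ∘ suc))) (*-identityˡ (v₀ 0)))
         (trans (sum-cong-≗ (λ j → assoc -1ℤ (s j) (a j) (m j))) (sum-*ˡ -1ℤ (λ j → s j * a j * m j))) ⟩
  v₀ 0 * Φ (tabulate (v ∘ suc)) + -1ℤ * sum (λ j → s j * a j * m j)
    ≡⟨ cong (λ z → v₀ 0 * Φ (tabulate (v ∘ suc)) + z)
         (trans (cong (-1ℤ *_) (laplace-expand (Φ ∘ (v₀ ∷_)) (v ∘ suc))) (-1*i≡-i _)) ⟩
  expand Φ (tabulate v) ∎
  where
  v₀ = v zero
  s a m : Fin (suc n) → ℤ
  s j = -1ℤ ^ toℕ j
  a j = v (suc j) 0
  m j = Φ (v₀ ∷ tabulate (removeAt (v ∘ suc) j))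
  assoc : ∀ e s a m → (e * s) * a * m ≡ e * (s * a * m)
  assoc = solve-∀

det-Δ : ∀ n (v : Fin n → Col) → det (λ i j → v j (toℕ i)) ≡ Δ n (tabulate v)
det-Δ zero    v = refl
det-Δ (suc n) v = trans (sum-cong-≗ minor) (laplace-expand (Δ n ∘ map E) v)
  where
  minor : ∀ j → (-1ℤ ^ toℕ j) * v j 0 * det (λ i k → E (removeAt v j k) (toℕ i))
              ≡ (-1ℤ ^ toℕ j) * v j 0 * Δ n (map E (tabulate (removeAt v j)))
  minor j = cong ((-1ℤ ^ toℕ j) * v j 0 *_)
    (trans (det-Δ n (E ∘ removeAt v j))
           (cong (Δ n) (sym (map-tabulate (removeAt v j) E))))

det-cong : ∀ {n} {M N : Matrix n} → (∀ i j → M i j ≡ N i j) → det M ≡ det N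
det-cong {zero}  eq = refl
det-cong {suc n} eq = sum-cong-≗ (λ j → cong₂ (λ a m → (-1ℤ ^ toℕ j) * a * m)
  (eq zero j) (det-cong (λ i k → eq (suc i) (punchIn j k))))

-- Alternation and linearity in the columns

expand-cancel : ∀ {Φ Ψ} → (∀ xs → Φ xs + Ψ xs ≡ 0ℤ) → ∀ xs → expand Φ xs + expand Ψ xs ≡ 0ℤ
expand-cancel         h []       = refl
expand-cancel {Φ} {Ψ} h (x ∷ xs) = begin
  x 0 * Φ xs - p + (x 0 * Ψ xs - q) ≡⟨ lemma (x 0) (Φ xs) (Ψ xs) p q ⟩
  x 0 * (Φ xs + Ψ xs) - (p + q)     ≡⟨ cong₂ (λ u v → x 0 * u - v) (h xs) (expand-cancel (h ∘ (x ∷_)) xs) ⟩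
  x 0 * 0ℤ - 0ℤ                     ≡⟨ cong (_- 0ℤ) (*-zeroʳ (x 0)) ⟩
  0ℤ                                ∎
  where
  p = expand (Φ ∘ (x ∷_)) xs
  q = expand (Ψ ∘ (x ∷_)) xs
  lemma : ∀ a u v p q → a * u - p + (a * v - q) ≡ a * (u + v) - (p + q)
  lemma = solve-∀

Alternating : (List Col → ℤ) → Set
Alternating Φ = ∀ ps x y qs → Φ (ps ++ x ∷ y ∷ qs) + Φ (ps ++ y ∷ x ∷ qs) ≡ 0ℤ

-- Exchanging the first two columns swaps the terms that delete them, with opposite signs; the other
-- minors contain both columns and cancel by alternation of `Φ`.
expand-alternating : ∀ {Φ} → Alternating Φ → Alternating (expand Φ)
expand-alternating {Φ} alt [] x y qs = begin
  a * u - (b * v - p) + (b * v - (a * u - q)) ≡⟨ lemma a b u v p q ⟩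
  p + q                                       ≡⟨ expand-cancel (alt [] x y) qs ⟩
  0ℤ                                          ∎
  where
  a = x 0
  b = y 0
  u = Φ (y ∷ qs)
  v = Φ (x ∷ qs)
  p = expand (Φ ∘ (x ∷_) ∘ (y ∷_)) qs
  q = expand (Φ ∘ (y ∷_) ∘ (x ∷_)) qs
  lemma : ∀ a b u v p q → a * u - (b * v - p) + (b * v - (a * u - q)) ≡ p + q
  lemma = solve-∀
expand-alternating {Φ} alt (z ∷ ps) x y qs = begin
  z 0 * u - p + (z 0 * v - q) ≡⟨ lemma (z 0) u v p q ⟩
  z 0 * (u + v) - (p + q)     ≡⟨ cong₂ (λ s t → z 0 * s - t) (alt ps x y qs)
                                   (expand-alternating (alt ∘ (z ∷_)) ps x y qs) ⟩
  z 0 * 0ℤ - 0ℤ               ≡⟨ cong (_- 0ℤ) (*-zeroʳ (z 0)) ⟩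
  0ℤ                          ∎
  where
  u = Φ (ps ++ x ∷ y ∷ qs)
  v = Φ (ps ++ y ∷ x ∷ qs)
  p = expand (Φ ∘ (z ∷_)) (ps ++ x ∷ y ∷ qs)
  q = expand (Φ ∘ (z ∷_)) (ps ++ y ∷ x ∷ qs)
  lemma : ∀ a u v p q → a * u - p + (a * v - q) ≡ a * (u + v) - (p + q)
  lemma = solve-∀

LinearLast : (List Col → ℤ) → Set
LinearLast Φ = ∀ ps s w x y → (∀ i → w i ≡ s * x i + y i) →
  Φ (ps ∷ʳ w) ≡ s * Φ (ps ∷ʳ x) + Φ (ps ∷ʳ y)

expand-linearLast : ∀ {Φ} → LinearLast Φ → LinearLast (expand Φ)
expand-linearLast {Φ} lin [] s w x y eq = begin
  w 0 * Φ [] - 0ℤ              ≡⟨ cong (λ z → z * Φ [] - 0ℤ) (eq 0) ⟩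
  (s * x 0 + y 0) * Φ [] - 0ℤ  ≡⟨ lemma s (x 0) (y 0) (Φ []) ⟩
  s * (x 0 * Φ [] - 0ℤ) + (y 0 * Φ [] - 0ℤ) ∎
  where
  lemma : ∀ s x y u → (s * x + y) * u - 0ℤ ≡ s * (x * u - 0ℤ) + (y * u - 0ℤ)
  lemma = solve-∀
expand-linearLast {Φ} lin (z ∷ ps) s w x y eq =
  trans (cong₂ (λ u v → z 0 * u - v) (lin ps s w x y eq)
                                     (expand-linearLast (lin ∘ (z ∷_)) ps s w x y eq))
        (lemma (z 0) s _ _ (Φz (ps ∷ʳ x)) (Φz (ps ∷ʳ y)))
  where
  Φz = expand (Φ ∘ (z ∷_))
  lemma : ∀ a s u v p q → a * (s * u + v) - (s * p + q) ≡ s * (a * u - p) + (a * v - q)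
  lemma = solve-∀

Δ-alternating : ∀ n → Alternating (Δ n)
Δ-alternating zero    []      x y qs = refl
Δ-alternating zero    (_ ∷ _) x y qs = refl
Δ-alternating (suc n) = expand-alternating alt
  where
  alt : Alternating (Δ n ∘ map E)
  alt ps x y qs rewrite map-++ E ps (x ∷ y ∷ qs) | map-++ E ps (y ∷ x ∷ qs) =
    Δ-alternating n (map E ps) (E x) (E y) (map E qs)

Δ-linearLast : ∀ n → LinearLast (Δ n)
Δ-linearLast zero    []      s w x y eq = sym (trans (+-identityʳ (s * 0ℤ)) (*-zeroʳ s))
Δ-linearLast zero    (_ ∷ _) s w x y eq = sym (trans (+-identityʳ (s * 0ℤ)) (*-zeroʳ s))
Δ-linearLast (suc n) = expand-linearLast lin
  where
  lin : LinearLast (Δ n ∘ map E)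
  lin ps s w x y eq
    rewrite map-++ E ps (w ∷ []) | map-++ E ps (x ∷ []) | map-++ E ps (y ∷ []) =
    Δ-linearLast n (map E ps) s (E w) (E x) (E y) (eq ∘ suc)

-- Exchanges of neighbours carry the first copy to the right until the copies are adjacent, where
-- alternation gives 2u = 0.
alternating-repeated : ∀ {Φ} → Alternating Φ → ∀ ps x qs → Φ (ps ++ x ∷ (qs ∷ʳ x)) ≡ 0ℤ
alternating-repeated {Φ} alt ps x [] =
  *-cancelˡ-≡ (+ 2) u 0ℤ (trans (double u) (alt ps x x []))
  where
  u = Φ (ps ++ x ∷ x ∷ [])
  double : ∀ i → + 2 * i ≡ i + i
  double = solve-∀
alternating-repeated {Φ} alt ps x (q ∷ qs) = begin
  Φ (ps ++ x ∷ q ∷ (qs ∷ʳ x))     ≡⟨ +-identityʳ _ ⟨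
  Φ (ps ++ x ∷ q ∷ (qs ∷ʳ x)) + 0ℤ ≡⟨ cong (λ z → Φ (ps ++ x ∷ q ∷ (qs ∷ʳ x)) + z) swapped ⟨
  Φ (ps ++ x ∷ q ∷ (qs ∷ʳ x)) + Φ (ps ++ q ∷ x ∷ (qs ∷ʳ x)) ≡⟨ alt ps x q (qs ∷ʳ x) ⟩
  0ℤ ∎
  where
  swapped : Φ (ps ++ q ∷ x ∷ (qs ∷ʳ x)) ≡ 0ℤ
  swapped = trans (cong Φ (sym (++-assoc ps (q ∷ []) (x ∷ (qs ∷ʳ x)))))
                  (alternating-repeated {Φ} alt (ps ∷ʳ q) x qs)

-- The term that deletes `w` has the factor `w 0`; every other minor still ends in `w` and releases
-- the factor `t`.
expand-last : ∀ {Φ Ψ} ps w t → w 0 ≡ 0ℤ →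
  (∀ qs → suc (length qs) ≡ length ps → Φ (qs ∷ʳ w) ≡ t * Ψ qs) →
  expand Φ (ps ∷ʳ w) ≡ t * expand Ψ ps
expand-last {Φ} [] w t w₀≡0 h = trans (cong (λ z → z * Φ [] - 0ℤ) w₀≡0) (sym (*-zeroʳ t))
expand-last {Φ} {Ψ} (z ∷ ps) w t w₀≡0 h =
  trans (cong₂ (λ u v → z 0 * u - v) (h ps refl)
               (expand-last {Φ ∘ (z ∷_)} {Ψ ∘ (z ∷_)} ps w t w₀≡0
                  (λ qs eq → h (z ∷ qs) (cong suc eq))))
        (lemma (z 0) t (Ψ ps) (expand (Ψ ∘ (z ∷_)) ps))
  where
  lemma : ∀ a t u v → a * (t * u) - t * v ≡ t * (a * u - v)
  lemma = solve-∀

-- The zeros keep `w` as last column through every expansion along the top row, down to its bottom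
-- entry, whose cofactor has sign +.
Δ-last : ∀ n ps w → length ps ≡ n → (∀ i → i < n → w i ≡ 0ℤ) →
  Δ (suc n) (ps ∷ʳ w) ≡ w n * Δ n ps
Δ-last zero [] w len low = +-identityʳ (w 0 * 1ℤ)
Δ-last (suc n) ps w len low = expand-last ps w (w (suc n)) (low 0 (s≤s z≤n)) minor
  where
  minor : ∀ qs → suc (length qs) ≡ length ps →
    Δ (suc n) (map E (qs ∷ʳ w)) ≡ w (suc n) * Δ n (map E qs)
  minor qs eq rewrite map-++ E qs (w ∷ []) =
    Δ-last n (map E qs) (E w) (trans (length-map E qs) (ℕₚ.suc-injective (trans eq len)))
      (λ i i<n → low (suc i) (s≤s i<n))

-- Hankel determinants and the columns spanned by shifts of a sequence

shift : ℕ → Col → Col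
shift k f i = f (i ℕ.+ k)

-- Columns of the polynomials of degree below n for the functional with moments `f`. The pointwise
-- equations make membership invariant under pointwise equality.
data Span (f : Col) (n : ℕ) : Col → Set where
  null : ∀ {u} → (∀ i → u i ≡ 0ℤ) → Span f n u
  add  : ∀ {u} k s v → k < n → (∀ i → u i ≡ s * shift k f i + v i) → Span f n v → Span f n u

-- d may exceed n: by parity, the combinations for cbar of degree 2m + 1 do not involve the
-- shift by 2m, which hankel-step₂ exploits.
record Lead (f : Col) (n d : ℕ) (s : ℤ) (w : Col) : Set where
  constructor lead
  field
    rest : Col
    eq   : ∀ i → w i ≡ s * shift d f i + rest i
    span : Span f n rest

hankelCols : Col → ℕ → List Col
hankelCols f = applyUpTo (λ k → shift k f)

hankel : Col → ℕ → ℤ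
hankel f n = Δ n (hankelCols f n)

tabulate-toℕ : ∀ {A : Set} n (g : ℕ → A) → tabulate {n = n} (g ∘ toℕ) ≡ applyUpTo g n
tabulate-toℕ zero    g = refl
tabulate-toℕ (suc n) g = cong (g 0 ∷_) (tabulate-toℕ n (g ∘ suc))

det-hankel : ∀ n f → det {n} (λ i j → f (toℕ i ℕ.+ toℕ j)) ≡ hankel f n
det-hankel n f = trans (det-Δ n (λ j → shift (toℕ j) f))
                       (cong (Δ n) (tabulate-toℕ n (λ k → shift k f)))

-- Linearity splits the last column into multiples of columns that `ps` contains, each giving a
-- repetition.
Δ-span : ∀ {f n u ps} → Span f n u → (∀ {k} → k < n → shift k f ∈ ps) →
  ∀ N → Δ N (ps ∷ʳ u) ≡ 0ℤ
Δ-span {u = u} {ps} (null u≡0) mem N = trans lin (cancel (Δ N (ps ∷ʳ u)))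
  where
  cancel : ∀ z → -1ℤ * z + z ≡ 0ℤ
  cancel = solve-∀
  -- A zero column is minus itself plus itself.
  lin : Δ N (ps ∷ʳ u) ≡ -1ℤ * Δ N (ps ∷ʳ u) + Δ N (ps ∷ʳ u)
  lin = Δ-linearLast N ps -1ℤ u u u (λ i → trans (u≡0 i) (sym (cancel (u i))))
Δ-span {f} {u = u} {ps} (add k s v k<n eq sp) mem N = begin
  Δ N (ps ∷ʳ u)                             ≡⟨ Δ-linearLast N ps s u (shift k f) v eq ⟩
  s * Δ N (ps ∷ʳ shift k f) + Δ N (ps ∷ʳ v) ≡⟨ cong₂ (λ a b → s * a + b) repeated (Δ-span sp mem N) ⟩
  s * 0ℤ + 0ℤ                               ≡⟨ trans (+-identityʳ (s * 0ℤ)) (*-zeroʳ s) ⟩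
  0ℤ                                        ∎
  where
  repeated : Δ N (ps ∷ʳ shift k f) ≡ 0ℤ
  repeated with as , bs , ps≡ ← ∈-∃++ (mem k<n) =
    trans (cong (λ z → Δ N (z ∷ʳ shift k f)) ps≡)
      (trans (cong (Δ N) (++-assoc as (shift k f ∷ bs) (shift k f ∷ [])))
        (alternating-repeated {Δ N} (Δ-alternating N) as (shift k f) bs))

-- Column reduction of the last column. Only membership in `ps` is asked, so `ps` may also hold the
-- shift by n + 1, as in `hankel-step₂`.
Δ-replaceLast : ∀ {f n d s w} ps → Lead f n d s w → (∀ {k} → k < n → shift k f ∈ ps) →
  ∀ N → Δ N (ps ∷ʳ w) ≡ s * Δ N (ps ∷ʳ shift d f)
Δ-replaceLast {f} {d = d} {s} {w} ps (lead u eq sp) mem N =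
  trans (Δ-linearLast N ps s w (shift d f) u eq)
    (trans (cong (λ z → s * Δ N (ps ∷ʳ shift d f) + z) (Δ-span sp mem N)) (+-identityʳ _))

shift∈hankelCols : ∀ {f n k} → k < n → shift k f ∈ hankelCols f n
shift∈hankelCols {f} = ∈-applyUpTo⁺ (λ k → shift k f)

-- The determinant with last column `w` is computed twice: by column reduction, and by expansion
-- along `w`.
hankel-step : ∀ {f n s w} → Lead f n n s w →
  (∀ i → i < n → w i ≡ 0ℤ) → s * hankel f (suc n) ≡ w n * hankel f n
hankel-step {f} {n} {s} {w} L low = begin
  s * Δ (suc n) (hankelCols f (suc n))              ≡⟨ cong (λ z → s * Δ (suc n) z) (applyUpTo-∷ʳ (λ k → shift k f) n) ⟨
  s * Δ (suc n) (hankelCols f n ∷ʳ shift n f)       ≡⟨ Δ-replaceLast (hankelCols f n) L (shift∈hankelCols {f}) (suc n) ⟨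
  Δ (suc n) (hankelCols f n ∷ʳ w)                   ≡⟨ Δ-last n (hankelCols f n) w (length-applyUpTo (λ k → shift k f) n) low ⟩
  w n * hankel f n                                  ∎

-- When the last two columns reduce to (0, …, 0, t) and (0, …, 0, t, 0), their exchange
-- makes the matrix triangular.
hankel-step₂ : ∀ {f n s w w′ t} → Lead f n n s w → Lead f n (suc n) s w′ →
  (∀ i → i < suc n → w i ≡ 0ℤ) → w (suc n) ≡ t →
  (∀ i → i < n → w′ i ≡ 0ℤ) → w′ n ≡ t →
  s * (s * hankel f (suc (suc n))) ≡ - (t * (t * hankel f n))
hankel-step₂ {f} {n} {s} {w} {w′} {t = t} L L′ low wt low′ wt′ = begin
  s * (s * hankel f (2 ℕ.+ n))                   ≡⟨ cong (λ z → s * (s * z)) swap ⟩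
  s * (s * - Δ (2 ℕ.+ n) (qs ∷ʳ v))               ≡⟨ lemma s (Δ (2 ℕ.+ n) (qs ∷ʳ v)) ⟩
  - (s * (s * Δ (2 ℕ.+ n) (qs ∷ʳ v)))             ≡⟨ cong (λ z → - (s * z)) first ⟩
  - (s * (t * Δ (1 ℕ.+ n) (ps ∷ʳ v′)))            ≡⟨ cong -_ (comm s t _) ⟩
  - (t * (s * Δ (1 ℕ.+ n) (ps ∷ʳ v′)))            ≡⟨ cong (λ z → - (t * z)) second ⟩
  - (t * (t * hankel f n))                       ∎
  where
  ps = hankelCols f n
  v  = shift n f
  v′ = shift (suc n) f
  qs = ps ∷ʳ v′
  len : length ps ≡ n
  len = length-applyUpTo (λ k → shift k f) n
  lemma : ∀ s d → s * (s * - d) ≡ - (s * (s * d))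
  lemma = solve-∀
  comm : ∀ s t d → s * (t * d) ≡ t * (s * d)
  comm = solve-∀
  swap : hankel f (2 ℕ.+ n) ≡ - Δ (2 ℕ.+ n) (qs ∷ʳ v)
  swap = begin
    hankel f (2 ℕ.+ n)                  ≡⟨ cong (Δ (2 ℕ.+ n)) (applyUpTo-∷ʳ (λ k → shift k f) (suc n)) ⟨
    Δ (2 ℕ.+ n) (hankelCols f (suc n) ∷ʳ v′) ≡⟨ cong (λ z → Δ (2 ℕ.+ n) (z ∷ʳ v′)) (applyUpTo-∷ʳ (λ k → shift k f) n) ⟨
    Δ (2 ℕ.+ n) ((ps ∷ʳ v) ∷ʳ v′)        ≡⟨ cong (Δ (2 ℕ.+ n)) (++-assoc ps (v ∷ []) (v′ ∷ [])) ⟩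
    Δ (2 ℕ.+ n) (ps ++ v ∷ v′ ∷ [])      ≡⟨ neg-unique _ _ (Δ-alternating (2 ℕ.+ n) ps v v′ []) ⟩
    - Δ (2 ℕ.+ n) (ps ++ v′ ∷ v ∷ [])    ≡⟨ cong (λ z → - Δ (2 ℕ.+ n) z) (++-assoc ps (v′ ∷ []) (v ∷ [])) ⟨
    - Δ (2 ℕ.+ n) (qs ∷ʳ v)              ∎
    where
    neg-unique : ∀ a b → a + b ≡ 0ℤ → a ≡ - b
    neg-unique a b a+b≡0 = trans (split a b) (trans (cong (_+ - b) a+b≡0) (+-identityˡ (- b)))
      where
      split : ∀ a b → a ≡ (a + b) + - b
      split = solve-∀
  first : s * Δ (2 ℕ.+ n) (qs ∷ʳ v) ≡ t * Δ (1 ℕ.+ n) qs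
  first = begin
    s * Δ (2 ℕ.+ n) (qs ∷ʳ v)   ≡⟨ Δ-replaceLast qs L (∈-++⁺ˡ ∘ shift∈hankelCols {f}) (2 ℕ.+ n) ⟨
    Δ (2 ℕ.+ n) (qs ∷ʳ w)       ≡⟨ Δ-last (suc n) qs w (trans (length-++-comm ps (v′ ∷ [])) (cong suc len)) low ⟩
    w (suc n) * Δ (suc n) qs    ≡⟨ cong (_* Δ (suc n) qs) wt ⟩
    t * Δ (suc n) qs            ∎
  second : s * Δ (1 ℕ.+ n) (ps ∷ʳ v′) ≡ t * hankel f n
  second = begin
    s * Δ (suc n) (ps ∷ʳ v′)  ≡⟨ Δ-replaceLast ps L′ (shift∈hankelCols {f}) (suc n) ⟨
    Δ (suc n) (ps ∷ʳ w′)      ≡⟨ Δ-last n ps w′ len low′ ⟩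
    w′ n * hankel f n         ≡⟨ cong (_* hankel f n) wt′ ⟩
    t * hankel f n            ∎

-- Doubling, and the moments of the signed aerated Catalan functional

dbl : ℕ → ℕ
dbl zero    = zero
dbl (suc n) = suc (suc (dbl n))

-- `dbl` exposes two successors by computation, which `2 * n` does not; this leads back to the form
-- of the statement.
dbl≡2* : ∀ n → dbl n ≡ 2 ℕ.* n
dbl≡2* zero    = refl
dbl≡2* (suc n) = trans (cong (2 ℕ.+_) (dbl≡2* n)) (sym (ℕₚ.*-suc 2 n))

-- α n i is L(xⁱ pₙ) for the functional L whose moments are the signed aerated
-- Catalan numbers and its orthogonal polynomials pₙ₊₂ = x pₙ₊₁ + pₙ.
α : ℕ → Col
α zero    zero    = 1ℤ
α (suc n) zero    = 0ℤ
α zero    (suc i) = α 1 i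
α (suc n) (suc i) = α (2 ℕ.+ n) i - α n i

-- Orthogonality. Each use of x pₙ₊₁ = pₙ₊₂ - pₙ spends one power of x and lowers the index by at
-- most one, so the index is still positive when the powers run out.
α-low : ∀ i n → i < n → α n i ≡ 0ℤ
α-low zero    (suc n) _           = refl
α-low (suc i) (suc n) (s≤s i<n) =
  cong₂ _-_ (α-low i (2 ℕ.+ n) (ℕₚ.m≤n⇒m≤o+n 2 i<n)) (α-low i n i<n)

α-diag-suc : ∀ n → α (suc n) (suc n) ≡ - α n n
α-diag-suc n = trans (cong (_- α n n) (α-low n (2 ℕ.+ n) (s≤s (ℕₚ.n≤1+n n)))) (+-identityˡ (- α n n))

α-diag-even : ∀ k → α (dbl k) (dbl k) ≡ 1ℤ
α-diag-even zero    = refl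
α-diag-even (suc k) = trans (α-diag-suc (suc (dbl k))) (trans (cong -_ (α-diag-suc (dbl k)))
  (trans (neg-involutive (α (dbl k) (dbl k))) (α-diag-even k)))

α-diag-odd : ∀ k → α (suc (dbl k)) (suc (dbl k)) ≡ -1ℤ
α-diag-odd k = trans (α-diag-suc (dbl k)) (cong -_ (α-diag-even k))

-- xⁱ pₙ has the parity of n + i, and L vanishes on odd polynomials.
α-odd : ∀ k n i → n ℕ.+ i ≡ suc (dbl k) → α n i ≡ 0ℤ
α-odd k zero    zero    ()
α-odd k (suc n) zero    eq = refl
α-odd k zero    (suc i) eq = α-odd k 1 i eq
α-odd k (suc n) (suc i) eq with k
... | zero  with () ← trans (sym (ℕₚ.+-suc n i)) (ℕₚ.suc-injective eq)
... | suc k′ = cong₂ _-_ (α-odd (suc k′) (2 ℕ.+ n) i (trans (cong suc (sym (ℕₚ.+-suc n i))) eq))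
                         (α-odd k′ n i (ℕₚ.suc-injective (ℕₚ.suc-injective (trans (cong suc (sym (ℕₚ.+-suc n i))) eq))))

-- Ballot numbers

binom : ℕ → ℕ → ℤ
binom n k = + (n C k)

-- By reflection, for 2k ≤ n, the number of walks of n steps ±1 from 0 with k down steps that never
-- go below 0.
ballot : ℕ → ℕ → ℤ
ballot n zero    = 1ℤ
ballot n (suc k) = binom n (suc k) - binom n k

nC0≡1 : ∀ n → n C 0 ≡ 1
nC0≡1 n = trans (nCk≡nC[n∸k] {0} {n} z≤n) (nCn≡1 n)

pascal : ∀ n k → binom (suc n) (suc k) ≡ binom n k + binom n (suc k)
pascal n k = cong +_ (sym (nCk+nC[k+1]≡[n+1]C[k+1] n k))

ballot-pascal : ∀ n k → ballot (suc n) (suc k) ≡ ballot n (suc k) + ballot n k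
ballot-pascal n zero = begin
  binom (suc n) 1 - binom (suc n) 0        ≡⟨ cong₂ _-_ (pascal n 0) (cong +_ (nC0≡1 (suc n))) ⟩
  binom n 0 + binom n 1 - 1ℤ               ≡⟨ cong (λ z → z + binom n 1 - 1ℤ) (cong +_ (nC0≡1 n)) ⟩
  1ℤ + binom n 1 - 1ℤ                      ≡⟨ lemma (binom n 1) ⟩
  binom n 1 - 1ℤ + 1ℤ                      ≡⟨ cong (λ z → binom n 1 - z + 1ℤ) (cong +_ (nC0≡1 n)) ⟨
  binom n 1 - binom n 0 + 1ℤ               ∎
  where
  lemma : ∀ b → 1ℤ + b - 1ℤ ≡ b - 1ℤ + 1ℤ
  lemma = solve-∀
ballot-pascal n (suc k) =
  trans (cong₂ _-_ (pascal n (suc k)) (pascal n k)) (lemma (binom n k) (binom n (suc k)) (binom n (2 ℕ.+ k)))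
  where
  lemma : ∀ a b c → b + c - (a + b) ≡ c - b + (b - a)
  lemma = solve-∀

-- Over ℤ the factor n - k may be negative, when both binomials vanish; Pascal's rule drives the
-- induction.
binom-absorb : ∀ n k → + suc k * binom n (suc k) ≡ (+ n - + k) * binom n k
binom-absorb zero    zero    = refl
binom-absorb zero    (suc k) = begin
  + (2 ℕ.+ k) * binom 0 (2 ℕ.+ k)   ≡⟨ cong (+ (2 ℕ.+ k) *_) (cong +_ (k>n⇒nCk≡0 {0} {2 ℕ.+ k} (s≤s z≤n))) ⟩
  + (2 ℕ.+ k) * 0ℤ                  ≡⟨ *-zeroʳ (+ (2 ℕ.+ k)) ⟩
  0ℤ                                ≡⟨ *-zeroʳ (0ℤ - + suc k) ⟨
  (0ℤ - + suc k) * 0ℤ               ≡⟨ cong ((0ℤ - + suc k) *_) (cong +_ (k>n⇒nCk≡0 {0} {suc k} (s≤s z≤n))) ⟨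
  (0ℤ - + suc k) * binom 0 (suc k)  ∎
binom-absorb (suc n) zero = begin
  1ℤ * binom (suc n) 1              ≡⟨ cong (1ℤ *_) (pascal n 0) ⟩
  1ℤ * (binom n 0 + binom n 1)      ≡⟨ lemma₁ (binom n 0) (binom n 1) ⟩
  binom n 0 + 1ℤ * binom n 1        ≡⟨ cong (λ z → binom n 0 + z) (binom-absorb n 0) ⟩
  binom n 0 + (+ n - 0ℤ) * binom n 0 ≡⟨ lemma₂ (+ n) (binom n 0) ⟩
  (1ℤ + + n - 0ℤ) * binom n 0       ≡⟨ cong ((1ℤ + + n - 0ℤ) *_) (cong +_ (trans (nC0≡1 n) (sym (nC0≡1 (suc n))))) ⟩
  (+ suc n - 0ℤ) * binom (suc n) 0  ∎
  where
  lemma₁ : ∀ a b → 1ℤ * (a + b) ≡ a + 1ℤ * b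
  lemma₁ = solve-∀
  lemma₂ : ∀ n a → a + (n - 0ℤ) * a ≡ (1ℤ + n - 0ℤ) * a
  lemma₂ = solve-∀
binom-absorb (suc n) (suc k) = begin
  (1ℤ + K) * binom (suc n) (2 ℕ.+ k) ≡⟨ cong ((1ℤ + K) *_) (pascal n (suc k)) ⟩
  (1ℤ + K) * (b + d)                 ≡⟨ *-distribˡ-+ (1ℤ + K) b d ⟩
  (1ℤ + K) * b + (1ℤ + K) * d        ≡⟨ cong (λ z → (1ℤ + K) * b + z) (binom-absorb n (suc k)) ⟩
  (1ℤ + K) * b + (+ n - K) * b       ≡⟨ lemma₁ (+ n) (+ k) b ⟩
  K * b + (1ℤ + + n - K) * b         ≡⟨ cong (_+ (1ℤ + + n - K) * b) (binom-absorb n k) ⟩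
  (+ n - + k) * a + (1ℤ + + n - K) * b ≡⟨ lemma₂ (+ n) (+ k) a b ⟩
  (1ℤ + + n - K) * (a + b)           ≡⟨ cong ((1ℤ + + n - K) *_) (pascal n k) ⟨
  (1ℤ + + n - K) * binom (suc n) (suc k) ∎
  where
  K = 1ℤ + + k
  a = binom n k
  b = binom n (suc k)
  d = binom n (2 ℕ.+ k)
  lemma₁ : ∀ n k b → (1ℤ + (1ℤ + k)) * b + (n - (1ℤ + k)) * b ≡ (1ℤ + k) * b + (1ℤ + n - (1ℤ + k)) * b
  lemma₁ = solve-∀
  lemma₂ : ∀ n k a b → (n - k) * a + (1ℤ + n - (1ℤ + k)) * b ≡ (1ℤ + n - (1ℤ + k)) * (a + b)
  lemma₂ = solve-∀

+dbl : ∀ k → + dbl k ≡ + k + + k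
+dbl k = cong +_ (trans (dbl≡2* k) (cong (k ℕ.+_) (ℕₚ.+-identityʳ k)))

-- Absorption has the factor k + 1 on both sides here, so the two central binomials agree.
ballot-middle : ∀ k → ballot (suc (dbl k)) (suc k) ≡ 0ℤ
ballot-middle k = trans (cong (_- binom n k) equal) (+-inverseʳ (binom n k))
  where
  n = suc (dbl k)
  coef : + n - + k ≡ + suc k
  coef = trans (cong (λ z → 1ℤ + z - + k) (+dbl k)) (lemma (+ k))
    where
    lemma : ∀ k → 1ℤ + (k + k) - k ≡ 1ℤ + k
    lemma = solve-∀
  equal : binom n (suc k) ≡ binom n k
  equal = *-cancelˡ-≡ (+ suc k) _ _ (trans (binom-absorb n k) (cong (_* binom n k) coef))

exact-quotient : ∀ k N y → + suc k * y ≡ + N → y ≡ + (N / suc k)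
exact-quotient k N (+ B) eq = cong +_ (sym (trans (/-congˡ N≡B*[1+k]) (m*n/n≡m B (suc k))))
  where
  N≡B*[1+k] : N ≡ B ℕ.* suc k
  N≡B*[1+k] = +-injective (trans (sym eq) (trans (sym (pos-* (suc k) B)) (cong +_ (ℕₚ.*-comm (suc k) B))))

-- Absorption gives k b₁ = (k + 1) b₀, hence (k + 1)(b₁ - b₀) = b₁.
ballot-catalan : ∀ k → ballot (dbl k) k ≡ + catalan k
ballot-catalan zero      = refl
ballot-catalan k@(suc j) =
  trans (exact-quotient k (dbl k C k) (b₁ - b₀) product)
        (cong (λ n → + ((n C k) / suc k)) (dbl≡2* k))
  where
  b₀ = binom (dbl k) j
  b₁ = binom (dbl k) k
  absorb : + k * b₁ ≡ (1ℤ + + k) * b₀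
  absorb = trans (binom-absorb (dbl k) j) (cong (_* b₀) (trans (cong (_- + j) (+dbl k)) (lemma (+ j))))
    where
    lemma : ∀ j → 1ℤ + j + (1ℤ + j) - j ≡ 1ℤ + (1ℤ + j)
    lemma = solve-∀
  product : (1ℤ + + k) * (b₁ - b₀) ≡ b₁
  product = trans (lemma₁ (+ k) b₀ b₁)
    (trans (cong (λ z → b₁ + z - (1ℤ + + k) * b₀) absorb) (lemma₂ b₁ ((1ℤ + + k) * b₀)))
    where
    lemma₁ : ∀ k a b → (1ℤ + k) * (b - a) ≡ b + k * b - (1ℤ + k) * a
    lemma₁ = solve-∀
    lemma₂ : ∀ b z → b + z - z ≡ b
    lemma₂ = solve-∀

-- Expanding L(xⁱ pₙ) by the recurrence walks from n to 0 on the naturals in i steps, each step down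
-- costing a sign. With i = n + 2k there are n + k steps down, and the reversed walks are those that
-- `ballot i k` counts.
α-ballot : ∀ k n i → i ≡ n ℕ.+ dbl k → α n i ≡ (-1ℤ ^ (n ℕ.+ k)) * ballot i k
α-ballot zero    zero    i refl = refl
α-ballot zero    (suc n) (suc i) refl = begin
  α (2 ℕ.+ n) i - α n i              ≡⟨ cong (_- α n i) (α-low i (2 ℕ.+ n) i<2+n) ⟩
  0ℤ - α n i                         ≡⟨ cong (λ z → 0ℤ - z) (α-ballot zero n i refl) ⟩
  0ℤ - (-1ℤ ^ (n ℕ.+ 0)) * 1ℤ        ≡⟨ lemma (-1ℤ ^ (n ℕ.+ 0)) ⟩
  (-1ℤ ^ (suc n ℕ.+ 0)) * 1ℤ         ∎
  where
  i<2+n : n ℕ.+ 0 < 2 ℕ.+ n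
  i<2+n = subst (_< 2 ℕ.+ n) (sym (ℕₚ.+-identityʳ n)) (s≤s (ℕₚ.n≤1+n n))
  lemma : ∀ s → 0ℤ - s * 1ℤ ≡ -1ℤ * s * 1ℤ
  lemma = solve-∀
α-ballot (suc k) zero    i refl = begin
  α 1 (suc (dbl k))                            ≡⟨ α-ballot k 1 (suc (dbl k)) refl ⟩
  -- From index 0 the walk can only go up; the other term of Pascal's rule is 0 by `ballot-middle`.
  s * ballot (suc (dbl k)) k                   ≡⟨ cong (s *_) (+-identityˡ (ballot (suc (dbl k)) k)) ⟨
  s * (0ℤ + ballot (suc (dbl k)) k)            ≡⟨ cong (λ z → s * (z + ballot (suc (dbl k)) k)) (ballot-middle k) ⟨
  s * (ballot (suc (dbl k)) (suc k) + ballot (suc (dbl k)) k) ≡⟨ cong (s *_) (ballot-pascal (suc (dbl k)) k) ⟨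
  s * ballot (2 ℕ.+ dbl k) (suc k)             ∎
  where s = -1ℤ ^ suc k
α-ballot (suc k) (suc n) (suc i) eq = begin
  α (2 ℕ.+ n) i - α n i
    ≡⟨ cong₂ _-_ (α-ballot k (2 ℕ.+ n) i (trans i≡ (trans (ℕₚ.+-suc n _) (cong suc (ℕₚ.+-suc n _)))))
                 (α-ballot (suc k) n i i≡) ⟩
  -1ℤ * (-1ℤ * s) * ballot i k - (-1ℤ ^ (n ℕ.+ suc k)) * ballot i (suc k)
    ≡⟨ cong (λ m → -1ℤ * (-1ℤ * s) * ballot i k - (-1ℤ ^ m) * ballot i (suc k)) (ℕₚ.+-suc n k) ⟩
  -1ℤ * (-1ℤ * s) * ballot i k - -1ℤ * s * ballot i (suc k)
    ≡⟨ lemma s (ballot i k) (ballot i (suc k)) ⟩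
  -1ℤ * (-1ℤ * s) * (ballot i (suc k) + ballot i k)
    ≡⟨ cong₂ (λ m z → -1ℤ * (-1ℤ ^ m) * z) (sym (ℕₚ.+-suc n k)) (sym (ballot-pascal i k)) ⟩
  -1ℤ * (-1ℤ ^ (n ℕ.+ suc k)) * ballot (suc i) (suc k) ∎
  where
  s = -1ℤ ^ (n ℕ.+ k)
  i≡ : i ≡ n ℕ.+ dbl (suc k)
  i≡ = ℕₚ.suc-injective eq
  lemma : ∀ s b b′ → -1ℤ * (-1ℤ * s) * b - -1ℤ * s * b′ ≡ -1ℤ * (-1ℤ * s) * (b′ + b)
  lemma = solve-∀

-- The sequence `c` as moments of L((1 + x) ·)

G : ℕ → Col
G n i = α n i + α n (suc i)

even-odd : ∀ {P : ℕ → Set} → (∀ k → P (dbl k)) → (∀ k → P (suc (dbl k))) → ∀ n → P n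
even-odd e o zero          = e zero
even-odd e o (suc zero)    = o zero
even-odd e o (suc (suc n)) = even-odd (e ∘ suc) (o ∘ suc) n

α-even : ∀ k → α 0 (dbl k) ≡ (-1ℤ ^ k) * + catalan k
α-even k = trans (α-ballot k 0 (dbl k) refl) (cong ((-1ℤ ^ k) *_) (ballot-catalan k))

-- Of two consecutive moments of L the odd one vanishes, so every signed Catalan number past the
-- first occurs twice.
c≗G₀ : ∀ i → c i ≡ G 0 i
c≗G₀ = even-odd {λ i → c i ≡ G 0 i} even odd
  where
  even : ∀ k → c (dbl k) ≡ G 0 (dbl k)
  even k = begin
    c (dbl k)                             ≡⟨ cong c (dbl≡2* k) ⟩
    c (2 ℕ.* k)                           ≡⟨ c-even k ⟩
    (-1ℤ ^ k) * + catalan k               ≡⟨ α-even k ⟨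
    α 0 (dbl k)                           ≡⟨ +-identityʳ _ ⟨
    α 0 (dbl k) + 0ℤ                      ≡⟨ cong (λ z → α 0 (dbl k) + z) (α-odd k 0 _ refl) ⟨
    α 0 (dbl k) + α 0 (suc (dbl k))       ∎
  odd : ∀ k → c (suc (dbl k)) ≡ G 0 (suc (dbl k))
  odd k = begin
    c (suc (dbl k))                       ≡⟨ cong (c ∘ suc) (dbl≡2* k) ⟩
    c (suc (2 ℕ.* k))                     ≡⟨ c-odd k ⟩
    (-1ℤ ^ suc k) * + catalan (suc k)     ≡⟨ α-even (suc k) ⟨
    α 0 (dbl (suc k))                     ≡⟨ +-identityˡ _ ⟨
    0ℤ + α 0 (dbl (suc k))                ≡⟨ cong (_+ α 0 (dbl (suc k))) (α-odd k 0 _ refl) ⟨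
    α 0 (suc (dbl k)) + α 0 (dbl (suc k)) ∎

-- Closure properties of spans

span-≤ : ∀ {f m n u} → m ≤ n → Span f m u → Span f n u
span-≤ m≤n (null u≡0)          = null u≡0
span-≤ m≤n (add k s v k<m eq p) = add k s v (ℕₚ.<-≤-trans k<m m≤n) eq (span-≤ m≤n p)

span-+ : ∀ {f n u v} → Span f n u → Span f n v → Span f n (λ i → u i + v i)
span-+ {v = v} (null u≡0) (null v≡0) = null (λ i → cong₂ _+_ (u≡0 i) (v≡0 i))
span-+ {u = u} {v} (null u≡0) (add k s w k<n eq q) =
  add k s w k<n (λ i → trans (cong (_+ v i) (u≡0 i)) (trans (+-identityˡ (v i)) (eq i))) q
span-+ {f} {v = v} (add k s w k<n eq p) q = add k s (λ i → w i + v i) k<n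
  (λ i → trans (cong (_+ v i) (eq i)) (+-assoc (s * shift k f i) (w i) (v i))) (span-+ p q)

span-scale : ∀ {f n u} a → Span f n u → Span f n (λ i → a * u i)
span-scale a (null u≡0)          = null (λ i → trans (cong (a *_) (u≡0 i)) (*-zeroʳ a))
span-scale {f} a (add k s v k<n eq p) = add k (a * s) (λ i → a * v i) k<n
  (λ i → trans (cong (a *_) (eq i)) (lemma a s (shift k f i) (v i))) (span-scale a p)
  where
  lemma : ∀ a s x y → a * (s * x + y) ≡ a * s * x + a * y
  lemma = solve-∀

-- Multiplication by x with the functional kept: degrees rise by one.
span-E : ∀ {f n u} → Span f n u → Span f (suc n) (E u)
span-E (null u≡0)           = null (u≡0 ∘ suc)
span-E {f} (add k s v k<n eq p) = add (suc k) s (E v) (s≤s k<n)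
  (λ i → trans (eq (suc i)) (cong (λ j → s * f j + v (suc i)) (sym (ℕₚ.+-suc i k)))) (span-E p)

-- The factor x goes into the functional instead, so degrees stay.
span-tail : ∀ {f n u} → Span f n u → Span (E f) n (E u)
span-tail (null u≡0)           = null (u≡0 ∘ suc)
span-tail (add k s v k<n eq p) = add k s (E v) k<n (eq ∘ suc) (span-tail p)

lead-≗ : ∀ {f n d s w w′} → (∀ i → w i ≡ w′ i) → Lead f n d s w′ → Lead f n d s w
lead-≗ w≗w′ (lead u eq p) = lead u (λ i → trans (w≗w′ i) (eq i)) p

lead-≤ : ∀ {f m n d s w} → m ≤ n → Lead f m d s w → Lead f n d s w
lead-≤ m≤n (lead u eq p) = lead u eq (span-≤ m≤n p)

lead-+ : ∀ {f n d s w v} → Lead f n d s w → Span f n v → Lead f n d s (λ i → w i + v i)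
lead-+ {f} {d = d} {s} {w} {v} (lead u eq p) q = lead (λ i → u i + v i)
  (λ i → trans (cong (_+ v i) (eq i)) (+-assoc (s * shift d f i) (u i) (v i))) (span-+ p q)

lead-scale : ∀ {f n d w} a → Lead f n d 1ℤ w → Lead f n d a (λ i → a * w i)
lead-scale {f} {d = d} a (lead u eq p) = lead (λ i → a * u i)
  (λ i → trans (cong (a *_) (eq i)) (lemma a (shift d f i) (u i))) (span-scale a p)
  where
  lemma : ∀ a x y → a * (1ℤ * x + y) ≡ a * x + a * y
  lemma = solve-∀

lead-E : ∀ {f n d s w} → Lead f n d s w → Lead f (suc n) (suc d) s (E w)
lead-E {f} {d = d} {s} (lead u eq p) = lead (E u)
  (λ i → trans (eq (suc i)) (cong (λ j → s * f j + u (suc i)) (sym (ℕₚ.+-suc i d)))) (span-E p)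

lead-tail : ∀ {f n d s w} → Lead f n d s w → Lead (E f) n d s (E w)
lead-tail (lead u eq p) = lead (E u) (eq ∘ suc) (span-tail p)

lead⇒span : ∀ {f n s w} → Lead f n n s w → Span f (suc n) w
lead⇒span {n = n} {s} (lead u eq p) = add n s u ℕₚ.≤-refl eq (span-≤ (ℕₚ.n≤1+n n) p)

-- The orthogonal polynomials of x ↦ L((1 + x) ·) and x ↦ L(x (1 + x) ·)

φ : ℕ → ℤ
φ n = + F n

-- `G n` is the column of the monic pₙ for L((1 + x) ·); the step is x pₙ₊₁ + pₙ.
G-lead : ∀ n → Lead c n n 1ℤ (G n)
G-lead zero = lead (λ _ → 0ℤ)
  (λ i → trans (sym (c≗G₀ i)) (trans (cong c (sym (ℕₚ.+-identityʳ i))) (lemma (c (i ℕ.+ 0)))))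
  (null (λ _ → refl))
  where
  lemma : ∀ z → z ≡ 1ℤ * z + 0ℤ
  lemma = solve-∀
G-lead (suc zero)    = lead-E (G-lead zero)
G-lead (suc (suc n)) = lead-≗
  (λ i → lemma (α n i) (α (suc n) i) (α (2 ℕ.+ n) i) (α (3 ℕ.+ n) i) (α n (suc i)))
  (lead-+ (lead-E (G-lead (suc n))) (span-≤ (ℕₚ.n≤1+n (suc n)) (lead⇒span (G-lead n))))
  where
  lemma : ∀ a₀ a₁ a₂ a₃ b → a₂ + (a₃ - a₁) ≡ a₂ - a₀ + (a₃ - a₁ - b) + (a₀ + b)
  lemma = solve-∀

-- Columns of the Christoffel-Darboux kernels F₁ p₀ + ... + Fₙ₊₁ pₙ at -1: both pⱼ(-1) and L(pⱼ²)
-- carry the sign (-1)ʲ, so their quotient is Fⱼ₊₁.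
Q : ℕ → Col
Q zero    i = G 0 i
Q (suc n) i = φ (2 ℕ.+ n) * G (suc n) i + Q n i

Q-lead : ∀ n → Lead c n n (φ (suc n)) (Q n)
Q-lead zero    = G-lead 0
Q-lead (suc n) = lead-+ (lead-scale (φ (2 ℕ.+ n)) (G-lead (suc n))) (lead⇒span (Q-lead n))

-- Christoffel's formula at the root -1 of 1 + x, where pₙ(-1) = ± Fₙ₊₁.
Q-christoffel : ∀ n i → Q n i ≡ φ (suc n) * α (suc n) i + φ (2 ℕ.+ n) * α n i
Q-christoffel zero    i = lemma (α 0 i) (α 1 i)
  where
  lemma : ∀ a b → a + b ≡ 1ℤ * b + 1ℤ * a
  lemma = solve-∀
Q-christoffel (suc n) i =
  trans (cong (λ z → φ (2 ℕ.+ n) * G (suc n) i + z) (Q-christoffel n i))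
        (lemma (φ (suc n)) (φ (2 ℕ.+ n)) (α n i) (α (suc n) i) (α (2 ℕ.+ n) i))
  where
  lemma : ∀ p q a₀ a₁ a₂ → q * (a₁ + (a₂ - a₀)) + (p * a₁ + q * a₀) ≡ q * a₂ + (q + p) * a₁
  lemma = solve-∀

Q-low : ∀ n i → i < n → Q n i ≡ 0ℤ
Q-low n i i<n = begin
  Q n i                                          ≡⟨ Q-christoffel n i ⟩
  φ (suc n) * α (suc n) i + φ (2 ℕ.+ n) * α n i  ≡⟨ cong₂ (λ a b → φ (suc n) * a + φ (2 ℕ.+ n) * b)
                                                      (α-low i (suc n) (ℕₚ.m<n⇒m<1+n i<n)) (α-low i n i<n) ⟩
  φ (suc n) * 0ℤ + φ (2 ℕ.+ n) * 0ℤ              ≡⟨ lemma (φ (suc n)) (φ (2 ℕ.+ n)) ⟩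
  0ℤ                                             ∎
  where
  lemma : ∀ p q → p * 0ℤ + q * 0ℤ ≡ 0ℤ
  lemma = solve-∀

Q-diag : ∀ n → Q n n ≡ φ (2 ℕ.+ n) * α n n
Q-diag n = begin
  Q n n                                          ≡⟨ Q-christoffel n n ⟩
  φ (suc n) * α (suc n) n + φ (2 ℕ.+ n) * α n n  ≡⟨ cong (λ a → φ (suc n) * a + φ (2 ℕ.+ n) * α n n)
                                                      (α-low n (suc n) ℕₚ.≤-refl) ⟩
  φ (suc n) * 0ℤ + φ (2 ℕ.+ n) * α n n           ≡⟨ lemma (φ (suc n)) (φ (2 ℕ.+ n) * α n n) ⟩
  φ (2 ℕ.+ n) * α n n                            ∎
  where
  lemma : ∀ p q → p * 0ℤ + q ≡ q
  lemma = solve-∀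

-- S k corresponds to the polynomial p₂ₖ₊₁ / x.
S : ℕ → Col
S zero    i = G 0 i
S (suc k) i = G (dbl (suc k)) i + S k i

S-lead : ∀ k → Lead c (dbl k) (dbl k) 1ℤ (S k)
S-lead zero    = G-lead 0
S-lead (suc k) = lead-+ (G-lead (dbl (suc k))) (span-≤ (ℕₚ.n≤1+n _) (lead⇒span (S-lead k)))

-- x p₂ⱼ = p₂ⱼ₊₁ - p₂ⱼ₋₁ for j ≥ 1, so x (p₀ + p₂ + ... + p₂ₖ) telescopes.
E-S : ∀ k i → E (S k) i ≡ G (suc (dbl k)) i
E-S zero    i = refl
E-S (suc k) i = begin
  G (2 ℕ.+ d) (suc i) + E (S k) i       ≡⟨ cong (λ z → G (2 ℕ.+ d) (suc i) + z) (E-S k i) ⟩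
  G (2 ℕ.+ d) (suc i) + G (suc d) i     ≡⟨ lemma (α (suc d) i) (α (3 ℕ.+ d) i) (α (4 ℕ.+ d) i) (α (2 ℕ.+ d) i) (α (suc d) (suc i)) ⟩
  G (3 ℕ.+ d) i                         ∎
  where
  d = dbl k
  lemma : ∀ a₁ a₃ a₄ a₂ b → a₃ - a₁ + (a₄ - a₂ - b) + (a₁ + b) ≡ a₃ + (a₄ - a₂)
  lemma = solve-∀

-- The factor 1 + x costs one degree: p₂ₖ₊₁ has to annihilate both xⁱ and xⁱ⁺¹.
S-low : ∀ k i → i < dbl k → E (S k) i ≡ 0ℤ
S-low k i i< = trans (E-S k i)
  (cong₂ _+_ (α-low i (suc (dbl k)) (ℕₚ.m<n⇒m<1+n i<)) (α-low (suc i) (suc (dbl k)) (s≤s i<)))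

S-diag : ∀ k → E (S k) (dbl k) ≡ -1ℤ
S-diag k = trans (E-S k (dbl k))
  (cong₂ _+_ (α-low (dbl k) (suc (dbl k)) ℕₚ.≤-refl) (α-diag-odd k))

-- The sum of F₂ⱼ₊₂ (x - 1) p₂ⱼ₊₁ / x over j ≤ k. Times x (1 + x) its terms become F₂ⱼ₊₂ (p₂ⱼ₊₃ - 3
-- p₂ⱼ₊₁ + p₂ⱼ₋₁), with 0 for p₋₁, and telescope by F₂ⱼ₊₄ = 3 F₂ⱼ₊₂ - F₂ⱼ.
T : ℕ → Col
T zero    i = E (S 0) i - S 0 i
T (suc k) i = φ (4 ℕ.+ dbl k) * (E (S (suc k)) i - S (suc k) i) + T k i

S-difference-lead : ∀ k → Lead c (suc (dbl k)) (suc (dbl k)) 1ℤ (λ i → E (S k) i - S k i)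
S-difference-lead k = lead-≗ (λ i → cong (λ z → E (S k) i + z) (sym (-1*i≡-i (S k i))))
  (lead-+ (lead-E (S-lead k)) (span-scale -1ℤ (lead⇒span (S-lead k))))

T-lead : ∀ k → Lead c (suc (dbl k)) (suc (dbl k)) (φ (2 ℕ.+ dbl k)) (T k)
T-lead zero    = S-difference-lead 0
T-lead (suc k) = lead-+ (lead-scale (φ (4 ℕ.+ dbl k)) (S-difference-lead (suc k)))
  (span-≤ (ℕₚ.n≤1+n _) (lead⇒span (T-lead k)))

-- Christoffel's formula at the roots 0 and -1 of x (1 + x); p₂ₖ₊₂ is absent because
-- p₂ₖ₊₁ and p₂ₖ₊₃ are odd.
T-christoffel : ∀ k i → E (T k) i ≡
  φ (2 ℕ.+ dbl k) * α (3 ℕ.+ dbl k) i - φ (4 ℕ.+ dbl k) * α (suc (dbl k)) i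
T-christoffel zero i = lemma (α 0 i) (α 1 i) (α 2 i) (α 3 i)
  (α 1 (suc i))
  where
  lemma : ∀ a₀ a₁ a₂ a₃ b → b + (a₃ - a₁ - a₁) - (a₁ + b) ≡ 1ℤ * a₃ - + 3 * a₁
  lemma = solve-∀
T-christoffel (suc k) i = begin
  φ (4 ℕ.+ d) * (E (S (suc k)) (suc i) - E (S (suc k)) i) + E (T k) i
    ≡⟨ cong₂ (λ a b → φ (4 ℕ.+ d) * a + b) (cong₂ _-_ (E-S (suc k) (suc i)) (E-S (suc k) i)) (T-christoffel k i) ⟩
  φ (4 ℕ.+ d) * (G (3 ℕ.+ d) (suc i) - G (3 ℕ.+ d) i)
    + (φ (2 ℕ.+ d) * α (3 ℕ.+ d) i - φ (4 ℕ.+ d) * α (suc d) i)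
    ≡⟨ lemma (φ (2 ℕ.+ d)) (φ (3 ℕ.+ d)) (α (suc d) i) (α (3 ℕ.+ d) i) (α (5 ℕ.+ d) i) (α (3 ℕ.+ d) (suc i)) ⟩
  φ (4 ℕ.+ d) * α (5 ℕ.+ d) i - φ (6 ℕ.+ d) * α (3 ℕ.+ d) i ∎
  where
  d = dbl k
  -- `q + p` and `q + p + q + (q + p)` are the unfolded `φ (4 + d)` and `φ (6 + d)`.
  lemma : ∀ p q a₁ a₃ a₅ b →
    (q + p) * (b + (a₅ - a₃ - (a₃ - a₁)) - (a₃ + b)) + (p * a₃ - (q + p) * a₁) ≡
    (q + p) * a₅ - (q + p + q + (q + p)) * a₃
  lemma = solve-∀

T-low : ∀ k i → i < suc (dbl k) → E (T k) i ≡ 0ℤ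
T-low k i i< = begin
  E (T k) i                                       ≡⟨ T-christoffel k i ⟩
  p * α (3 ℕ.+ dbl k) i - q * α (suc (dbl k)) i   ≡⟨ cong₂ (λ a b → p * a - q * b)
                                                       (α-low i (3 ℕ.+ dbl k) (ℕₚ.m≤n⇒m≤o+n 2 i<))
                                                       (α-low i (suc (dbl k)) i<) ⟩
  p * 0ℤ - q * 0ℤ                                 ≡⟨ lemma p q ⟩
  0ℤ                                              ∎
  where
  p = φ (2 ℕ.+ dbl k)
  q = φ (4 ℕ.+ dbl k)
  lemma : ∀ p q → p * 0ℤ - q * 0ℤ ≡ 0ℤ
  lemma = solve-∀

T-diag : ∀ k → E (T k) (suc (dbl k)) ≡ φ (4 ℕ.+ dbl k)
T-diag k = begin
  E (T k) n                              ≡⟨ T-christoffel k n ⟩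
  p * α (2 ℕ.+ n) n - q * α n n          ≡⟨ cong₂ (λ a b → p * a - q * b)
                                              (α-low n (2 ℕ.+ n) (s≤s (ℕₚ.n≤1+n n))) (α-diag-odd k) ⟩
  p * 0ℤ - q * -1ℤ                       ≡⟨ lemma p q ⟩
  q                                      ∎
  where
  n = suc (dbl k)
  p = φ (2 ℕ.+ dbl k)
  q = φ (4 ℕ.+ dbl k)
  lemma : ∀ p q → p * 0ℤ - q * -1ℤ ≡ q
  lemma = solve-∀

-- The aerated sequence

interleave0-≗ : ∀ {f g} → (∀ i → f i ≡ g i) → ∀ i → interleave0 f i ≡ interleave0 g i
interleave0-≗ f≗g zero          = f≗g 0
interleave0-≗ f≗g (suc zero)    = refl
interleave0-≗ f≗g (suc (suc i)) = interleave0-≗ (f≗g ∘ suc) i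

interleave0-linear : ∀ {w x y} s → (∀ i → w i ≡ s * x i + y i) →
  ∀ i → interleave0 w i ≡ s * interleave0 x i + interleave0 y i
interleave0-linear s eq zero          = eq 0
interleave0-linear s eq (suc zero)    = sym (trans (+-identityʳ (s * 0ℤ)) (*-zeroʳ s))
interleave0-linear s eq (suc (suc i)) = interleave0-linear s (eq ∘ suc) i

interleave0-null : ∀ {u} → (∀ i → u i ≡ 0ℤ) → ∀ i → interleave0 u i ≡ 0ℤ
interleave0-null u≡0 zero          = u≡0 0
interleave0-null u≡0 (suc zero)    = refl
interleave0-null u≡0 (suc (suc i)) = interleave0-null (u≡0 ∘ suc) i

interleave0-shift : ∀ k f i → interleave0 (shift k f) i ≡ shift (dbl k) (interleave0 f) i
interleave0-shift zero    f i = trans (interleave0-≗ (λ j → cong f (ℕₚ.+-identityʳ j)) i)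
                                      (cong (interleave0 f) (sym (ℕₚ.+-identityʳ i)))
interleave0-shift (suc k) f i = begin
  interleave0 (shift (suc k) f) i       ≡⟨ interleave0-≗ (λ j → cong f (ℕₚ.+-suc j k)) i ⟩
  interleave0 (shift k (E f)) i         ≡⟨ interleave0-shift k (E f) i ⟩
  interleave0 f (2 ℕ.+ (i ℕ.+ dbl k))   ≡⟨ cong (interleave0 f) (trans (ℕₚ.+-suc i _) (cong suc (ℕₚ.+-suc i _))) ⟨
  interleave0 f (i ℕ.+ dbl (suc k))     ∎

dbl-mono-≤ : ∀ {m n} → m ≤ n → dbl m ≤ dbl n
dbl-mono-≤ z≤n       = z≤n
dbl-mono-≤ (s≤s m≤n) = s≤s (s≤s (dbl-mono-≤ m≤n))

interleave0-E-shift : ∀ k f i → E (interleave0 (shift k f)) i ≡ shift (suc (dbl k)) (interleave0 f) i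
interleave0-E-shift k f i = trans (interleave0-shift k f (suc i)) (cong (interleave0 f) (sym (ℕₚ.+-suc i (dbl k))))

interleave0-span : ∀ {f n u} → Span f n u → Span (interleave0 f) (dbl n) (interleave0 u)
interleave0-span (null u≡0) = null (interleave0-null u≡0)
interleave0-span {f} (add k s v k<n eq p) = add (dbl k) s (interleave0 v) (ℕₚ.<⇒≤ (dbl-mono-≤ k<n))
  (λ i → trans (interleave0-linear s eq i) (cong (λ z → s * z + interleave0 v i) (interleave0-shift k f i)))
  (interleave0-span p)

interleave0-lead : ∀ {f n s w} → Lead f n n s w → Lead (interleave0 f) (dbl n) (dbl n) s (interleave0 w)
interleave0-lead {f} {n} {s} (lead u eq p) = lead (interleave0 u)
  (λ i → trans (interleave0-linear s eq i) (cong (λ z → s * z + interleave0 u i) (interleave0-shift n f i)))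
  (interleave0-span p)

interleave0-E-span : ∀ {f n u} → Span f n u → Span (interleave0 f) (dbl n) (E (interleave0 u))
interleave0-E-span (null u≡0) = null (interleave0-null u≡0 ∘ suc)
interleave0-E-span {f} (add k s v k<n eq p) = add (suc (dbl k)) s (E (interleave0 v)) (dbl-mono-≤ k<n)
  (λ i → trans (interleave0-linear s eq (suc i))
               (cong (λ z → s * z + E (interleave0 v) i) (interleave0-E-shift k f i)))
  (interleave0-E-span p)

interleave0-E-lead : ∀ {f n s w} → Lead f n n s w →
  Lead (interleave0 f) (dbl n) (suc (dbl n)) s (E (interleave0 w))
interleave0-E-lead {f} {n} {s} (lead u eq p) = lead (E (interleave0 u))
  (λ i → trans (interleave0-linear s eq (suc i))
               (cong (λ z → s * z + E (interleave0 u) i) (interleave0-E-shift n f i)))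
  (interleave0-E-span p)

interleave0-low : ∀ n {w} → (∀ i → i < n → w i ≡ 0ℤ) → ∀ i → i < dbl n → interleave0 w i ≡ 0ℤ
interleave0-low (suc n) low zero          _               = low 0 (s≤s z≤n)
interleave0-low (suc n) low (suc zero)    _               = refl
interleave0-low (suc n) low (suc (suc i)) (s≤s (s≤s i<)) =
  interleave0-low n (λ j j<n → low (suc j) (s≤s j<n)) i i<

interleave0-dbl : ∀ n w → interleave0 w (dbl n) ≡ w n
interleave0-dbl zero    w = refl
interleave0-dbl (suc n) w = interleave0-dbl n (E w)

-- Recurrences for the Hankel determinants of `cbar` and `E cbar`

hankel-even-step : ∀ n →
  φ (suc n) * hankel cbar (suc (dbl n)) ≡ φ (2 ℕ.+ n) * α n n * hankel cbar (dbl n)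
hankel-even-step n = trans
  (hankel-step (interleave0-lead (Q-lead n)) (interleave0-low n (Q-low n)))
  (cong (_* hankel cbar (dbl n)) (trans (interleave0-dbl n (Q n)) (Q-diag n)))

-- `R` is an orthogonal polynomial of degree n for L(x (1 + x) ·), and x R(x²) is then one of degree
-- 2n + 1 for `cbar`. The parity of n decides whether `S` or `T` provides it.
module OddColumn (n : ℕ) (s t : ℤ) (R : Col) (R-lead : Lead c n n s R)
                 (R-low : ∀ i → i < n → E R i ≡ 0ℤ) (R-diag : E R n ≡ t) where

  low : ∀ i → i < suc (dbl n) → E (interleave0 R) i ≡ 0ℤ
  low zero    _        = refl
  low (suc i) (s≤s i<) = interleave0-low n R-low i i<

  diag : interleave0 (E R) (dbl n) ≡ t
  diag = trans (interleave0-dbl n (E R)) R-diag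

  hankel-odd-step : s * hankel cbar (2 ℕ.+ dbl n) ≡ t * hankel cbar (suc (dbl n))
  hankel-odd-step = trans
    (hankel-step (lead-≤ (ℕₚ.n≤1+n (dbl n)) (interleave0-E-lead R-lead)) low)
    (cong (_* hankel cbar (suc (dbl n))) diag)

  -- Against the moments `E cbar`, R(x²) annihilates even the power equal to its own degree 2n, so
  -- the diagonal entry vanishes.
  hankel′-odd : s * hankel (E cbar) (suc (dbl n)) ≡ 0ℤ
  hankel′-odd = trans
    (hankel-step (lead-tail (interleave0-lead R-lead)) (λ i i< → low i (ℕₚ.m<n⇒m<1+n i<)))
    (cong (_* hankel (E cbar) (dbl n)) (low (dbl n) ℕₚ.≤-refl))

  -- As the odd orders are singular, the recursion jumps by two: R(x²) and x R(x²) give the columns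
  -- (0, ..., 0, t) and (0, ..., 0, t, 0).
  hankel′-even-step : s * (s * hankel (E cbar) (2 ℕ.+ dbl n)) ≡ - (t * (t * hankel (E cbar) (dbl n)))
  hankel′-even-step = hankel-step₂
    (lead-tail (interleave0-lead R-lead)) (lead-tail (interleave0-E-lead R-lead))
    low diag (interleave0-low n R-low) diag

module EvenDegree (k : ℕ) = OddColumn (dbl k) 1ℤ -1ℤ (S k) (S-lead k) (S-low k) (S-diag k)

module OddDegree (k : ℕ) =
  OddColumn (suc (dbl k)) (φ (2 ℕ.+ dbl k)) (φ (4 ℕ.+ dbl k)) (T k) (T-lead k) (T-low k) (T-diag k)

-- Closed forms by cancelling Fibonacci factors

F-suc-nonZero : ∀ n → ℕ.NonZero (F (suc n))
F-suc-nonZero zero    = _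
F-suc-nonZero (suc n) = ℕ.>-nonZero (ℕₚ.<-≤-trans
  (ℕ.>-nonZero⁻¹ (F (suc n)) {{F-suc-nonZero n}})
  (ℕₚ.m≤m+n (F (suc n)) (F n)))

φ-cancel : ∀ n {x y} → φ (suc n) * x ≡ φ (suc n) * y → x ≡ y
φ-cancel n {x} {y} = *-cancelˡ-≡ (φ (suc n)) x y {{F-suc-nonZero n}}

-- A cycle of four steps, through `Q` at 2k, `S` at k, `Q` at 2k + 1 and `T` at k, with ratios F₂ₖ₊₂
-- / F₂ₖ₊₁, -1, -F₂ₖ₊₃ / F₂ₖ₊₂ and F₂ₖ₊₄ / F₂ₖ₊₂.
hankel-4k   : ∀ k → hankel cbar (dbl (dbl k))         ≡ φ (1 ℕ.+ dbl k) * φ (2 ℕ.+ dbl k)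
hankel-4k+1 : ∀ k → hankel cbar (1 ℕ.+ dbl (dbl k))   ≡ φ (2 ℕ.+ dbl k) * φ (2 ℕ.+ dbl k)
hankel-4k+2 : ∀ k → hankel cbar (2 ℕ.+ dbl (dbl k))   ≡ - (φ (2 ℕ.+ dbl k) * φ (2 ℕ.+ dbl k))
hankel-4k+3 : ∀ k → hankel cbar (3 ℕ.+ dbl (dbl k))   ≡ φ (2 ℕ.+ dbl k) * φ (3 ℕ.+ dbl k)

hankel-4k zero    = refl
hankel-4k (suc k) = φ-cancel (suc (dbl k)) (begin
  p * hankel cbar (4 ℕ.+ dbl (dbl k)) ≡⟨ OddDegree.hankel-odd-step k ⟩
  r * hankel cbar (3 ℕ.+ dbl (dbl k)) ≡⟨ cong (r *_) (hankel-4k+3 k) ⟩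
  r * (p * q)                         ≡⟨ lemma p q r ⟩
  p * (q * r)                         ∎)
  where
  p = φ (2 ℕ.+ dbl k)
  q = φ (3 ℕ.+ dbl k)
  r = φ (4 ℕ.+ dbl k)
  lemma : ∀ p q r → r * (p * q) ≡ p * (q * r)
  lemma = solve-∀

hankel-4k+1 k = φ-cancel (dbl k) (begin
  p * hankel cbar (1 ℕ.+ dbl (dbl k))               ≡⟨ hankel-even-step (dbl k) ⟩
  q * α (dbl k) (dbl k) * hankel cbar (dbl (dbl k)) ≡⟨ cong₂ (λ a h → q * a * h) (α-diag-even k) (hankel-4k k) ⟩
  q * 1ℤ * (p * q)                                  ≡⟨ lemma p q ⟩
  p * (q * q)                                       ∎)
  where
  p = φ (1 ℕ.+ dbl k)
  q = φ (2 ℕ.+ dbl k)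
  lemma : ∀ p q → q * 1ℤ * (p * q) ≡ p * (q * q)
  lemma = solve-∀

hankel-4k+2 k = begin
  hankel cbar (2 ℕ.+ dbl (dbl k))        ≡⟨ *-identityˡ _ ⟨
  1ℤ * hankel cbar (2 ℕ.+ dbl (dbl k))   ≡⟨ EvenDegree.hankel-odd-step k ⟩
  -1ℤ * hankel cbar (1 ℕ.+ dbl (dbl k))  ≡⟨ -1*i≡-i (hankel cbar (1 ℕ.+ dbl (dbl k))) ⟩
  - hankel cbar (1 ℕ.+ dbl (dbl k))      ≡⟨ cong -_ (hankel-4k+1 k) ⟩
  - (φ (2 ℕ.+ dbl k) * φ (2 ℕ.+ dbl k))  ∎

hankel-4k+3 k = φ-cancel (suc (dbl k)) (begin
  p * hankel cbar (3 ℕ.+ dbl (dbl k))    ≡⟨ hankel-even-step (suc (dbl k)) ⟩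
  q * α (suc (dbl k)) (suc (dbl k)) * hankel cbar (2 ℕ.+ dbl (dbl k))
                                         ≡⟨ cong₂ (λ a h → q * a * h) (α-diag-odd k) (hankel-4k+2 k) ⟩
  q * -1ℤ * - (p * p)                    ≡⟨ lemma p q ⟩
  p * (p * q)                            ∎)
  where
  p = φ (2 ℕ.+ dbl k)
  q = φ (3 ℕ.+ dbl k)
  lemma : ∀ p q → q * -1ℤ * - (p * p) ≡ p * (p * q)
  lemma = solve-∀

hankel′-odd : ∀ n → hankel (E cbar) (suc (dbl n)) ≡ 0ℤ
hankel′-odd = even-odd {λ n → hankel (E cbar) (suc (dbl n)) ≡ 0ℤ}
  (λ k → φ-cancel 0 (EvenDegree.hankel′-odd k))
  (λ k → φ-cancel (suc (dbl k)) (trans (OddDegree.hankel′-odd k) (sym (*-zeroʳ (φ (2 ℕ.+ dbl k))))))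

-- Here `S` and `T` alternate, with ratios -1 and -(F₂ₖ₊₄ / F₂ₖ₊₂)².
hankel′-4k   : ∀ k → hankel (E cbar) (dbl (dbl k))       ≡ φ (2 ℕ.+ dbl k) * φ (2 ℕ.+ dbl k)
hankel′-4k+2 : ∀ k → hankel (E cbar) (2 ℕ.+ dbl (dbl k)) ≡ - (φ (2 ℕ.+ dbl k) * φ (2 ℕ.+ dbl k))

hankel′-4k zero    = refl
hankel′-4k (suc k) = φ-cancel (suc (dbl k)) (φ-cancel (suc (dbl k)) (begin
  p * (p * hankel (E cbar) (4 ℕ.+ dbl (dbl k)))      ≡⟨ OddDegree.hankel′-even-step k ⟩
  - (r * (r * hankel (E cbar) (2 ℕ.+ dbl (dbl k))))  ≡⟨ cong (λ h → - (r * (r * h))) (hankel′-4k+2 k) ⟩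
  - (r * (r * - (p * p)))                            ≡⟨ lemma p r ⟩
  p * (p * (r * r))                                  ∎))
  where
  p = φ (2 ℕ.+ dbl k)
  r = φ (4 ℕ.+ dbl k)
  lemma : ∀ p r → - (r * (r * - (p * p))) ≡ p * (p * (r * r))
  lemma = solve-∀

hankel′-4k+2 k = begin
  h₂                                     ≡⟨ lemma₁ h₂ ⟩
  1ℤ * (1ℤ * h₂)                         ≡⟨ EvenDegree.hankel′-even-step k ⟩
  - (-1ℤ * (-1ℤ * h₀))                   ≡⟨ lemma₂ h₀ ⟩
  - h₀                                   ≡⟨ cong -_ (hankel′-4k k) ⟩
  - (φ (2 ℕ.+ dbl k) * φ (2 ℕ.+ dbl k))  ∎
  where
  h₀ = hankel (E cbar) (dbl (dbl k))
  h₂ = hankel (E cbar) (2 ℕ.+ dbl (dbl k))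
  lemma₁ : ∀ h → h ≡ 1ℤ * (1ℤ * h)
  lemma₁ = solve-∀
  lemma₂ : ∀ h → - (-1ℤ * (-1ℤ * h)) ≡ - h
  lemma₂ = solve-∀

-- Transfer to `dbar₀` and `dbar₁`

dbar₁-hankel : ∀ n → dbar₁ n ≡ hankel (E cbar) n
dbar₁-hankel n = trans (det-cong {n} (λ i j → cong cbar (ℕₚ.+-comm (toℕ i ℕ.+ toℕ j) 1)))
                       (det-hankel n (E cbar))

dbar₀-at : ∀ {m n} → m ≡ n → dbar₀ m ≡ hankel cbar n
dbar₀-at {m} refl = det-hankel m cbar

dbar₁-at : ∀ {m n} → m ≡ n → dbar₁ m ≡ hankel (E cbar) n
dbar₁-at {m} refl = dbar₁-hankel m

theorem2p3 : (n : ℕ) →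
    dbar₀ (4 ℕ.* n)         ≡ + (F (2 ℕ.* n ℕ.+ 1) ℕ.* F (2 ℕ.* n ℕ.+ 2))
    × dbar₀ (4 ℕ.* n ℕ.+ 1) ≡ + (F (2 ℕ.* n ℕ.+ 2) ℕ.^ 2)
    × dbar₀ (4 ℕ.* n ℕ.+ 2) ≡ - (+ (F (2 ℕ.* n ℕ.+ 2) ℕ.^ 2))
    × dbar₀ (4 ℕ.* n ℕ.+ 3) ≡ + (F (2 ℕ.* n ℕ.+ 2) ℕ.* F (2 ℕ.* n ℕ.+ 3))
    × dbar₁ (2 ℕ.* n ℕ.+ 1) ≡ 0ℤ
    × dbar₁ (4 ℕ.* n)       ≡ + (F (2 ℕ.* n ℕ.+ 2) ℕ.^ 2)
    × dbar₁ (4 ℕ.* n ℕ.+ 2) ≡ - (+ (F (2 ℕ.* n ℕ.+ 2) ℕ.^ 2))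
theorem2p3 n =
    trans (dbar₀-at 4n) (trans (hankel-4k n) (product 1 2))
  , trans (dbar₀-at (4n+ 1)) (trans (hankel-4k+1 n) square)
  , trans (dbar₀-at (4n+ 2)) (trans (hankel-4k+2 n) (cong -_ square))
  , trans (dbar₀-at (4n+ 3)) (trans (hankel-4k+3 n) (product 2 3))
  , trans (dbar₁-at (2n+ 1)) (hankel′-odd n)
  , trans (dbar₁-at 4n) (trans (hankel′-4k n) square)
  , trans (dbar₁-at (4n+ 2)) (trans (hankel′-4k+2 n) (cong -_ square))
  where
  4n : 4 ℕ.* n ≡ dbl (dbl n)
  4n = trans (ℕₚ.*-assoc 2 2 n) (trans (cong (2 ℕ.*_) (sym (dbl≡2* n))) (sym (dbl≡2* (dbl n))))
  4n+_ : ∀ j → 4 ℕ.* n ℕ.+ j ≡ j ℕ.+ dbl (dbl n)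
  4n+ j = trans (ℕₚ.+-comm (4 ℕ.* n) j) (cong (j ℕ.+_) 4n)
  2n+_ : ∀ j → 2 ℕ.* n ℕ.+ j ≡ j ℕ.+ dbl n
  2n+ j = trans (ℕₚ.+-comm (2 ℕ.* n) j) (cong (j ℕ.+_) (sym (dbl≡2* n)))
  product : ∀ i j → φ (i ℕ.+ dbl n) * φ (j ℕ.+ dbl n) ≡ + (F (2 ℕ.* n ℕ.+ i) ℕ.* F (2 ℕ.* n ℕ.+ j))
  product i j = trans (sym (pos-* (F (i ℕ.+ dbl n)) (F (j ℕ.+ dbl n))))
    (cong₂ (λ a b → + (F a ℕ.* F b)) (sym (2n+ i)) (sym (2n+ j)))
  square : φ (2 ℕ.+ dbl n) * φ (2 ℕ.+ dbl n) ≡ + (F (2 ℕ.* n ℕ.+ 2) ℕ.^ 2)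
  square = trans (product 2 2) (cong +_ (cong (f ℕ.*_) (sym (ℕₚ.*-identityʳ f))))
    where f = F (2 ℕ.* n ℕ.+ 2)
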